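{- Let $G=(V,E)$ be a finite connected graph (parallel edges allowed, no loops) with at least two vertices. Let $\kappa(G)$ denote the number of spanning trees of $G$ and $\kappa_2(G)$ the number of spanning forests of $G$ with exactly two connected components. Then \[ \frac{\kappa_2(G)}{\kappa(G)} \;\geq\; \frac{(|V|-1)^2}{4|E|}. \]
   Context: A spanning forest of $G$ is a subgraph containing all vertices of $G$ and no cycles; a two-forest is a spanning forest with exactly two connected components. -}

module Defs where

open import Data.Nat using (ℕ; suc; _≤_)
open import Data.Fin using (Fin)
open import Data.Fin.Subset using (Subset; _∈_)
open import Data.Fin.Subset using (⊤) public
open import Data.Product using (_×_; _,_; proj₁; proj₂; ∃; ∃-syntax)
open import Data.Sum using (_⊎_)
open import Data.List using (List; []; _∷_; length)
open import Data.List.Relation.Unary.Unique.Propositional using (Unique)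
open import Relation.Binary.PropositionalEquality using (_≡_; _≢_)
open import Relation.Nullary using (¬_)
import Data.List.Membership.Propositional as LM

-- A finite multigraph: vertices Fin n, edges Fin m, each edge with two
-- (unordered) endpoints; parallel edges are allowed (ends need not be injective).
record Multigraph : Set where
  field
    n    : ℕ
    m    : ℕ
    ends : Fin m → Fin n × Fin n

open Multigraph public

Loopless : Multigraph → Set
Loopless G = ∀ e → proj₁ (ends G e) ≢ proj₂ (ends G e)

Joins : (G : Multigraph) → Fin (m G) → Fin (n G) → Fin (n G) → Set
Joins G e u w = (ends G e ≡ (u , w)) ⊎ (ends G e ≡ (w , u))

data Walk (G : Multigraph) (S : Subset (m G)) : Fin (n G) → Fin (n G) → List (Fin (m G)) → Set where
  nil  : ∀ {u} → Walk G S u u []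
  cons : ∀ {u w v e es} → e ∈ S → Joins G e u w → Walk G S w v es → Walk G S u v (e ∷ es)

Connected : (G : Multigraph) → Subset (m G) → Fin (n G) → Fin (n G) → Set
Connected G S u v = ∃[ es ] Walk G S u v es

HasCycle : (G : Multigraph) → Subset (m G) → Set
HasCycle G S = ∃[ u ] ∃[ e ] ∃[ es ] (Walk G S u u (e ∷ es) × Unique (e ∷ es))

Acyclic : (G : Multigraph) → Subset (m G) → Set
Acyclic G S = ¬ HasCycle G S

IsConnectedGraph : Multigraph → Set
IsConnectedGraph G = ∀ u v → Connected G ⊤ u v

IsSpanningTree : (G : Multigraph) → Subset (m G) → Set
IsSpanningTree G S = Acyclic G S × (∀ u v → Connected G S u v)

IsTwoForest : (G : Multigraph) → Subset (m G) → Set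
IsTwoForest G S = Acyclic G S ×
  (∃[ a ] ∃[ b ] (¬ Connected G S a b × (∀ v → Connected G S a v ⊎ Connected G S b v)))

Enumerates : ∀ {k} → (Subset k → Set) → List (Subset k) → Set
Enumerates {k} P xs = Unique xs × (∀ (S : Subset k) → (S LM.∈ xs → P S) × (P S → S LM.∈ xs))

{-# OPTIONS --safe #-}
-- Fix a vertex q.  For a two-forest F let a_F(v) be 1 if F separates v from q and 0 otherwise, and
-- put N(v,w) = Σ_F a_F(v) a_F(w).  For every tree T the unit flow along the path of T from w to q
-- pairs with the gradient of any potential φ to φ(w) - φ(q); summed over T, since removing f from
-- the trees through f gives the two-forests cut by f, this says that N/κ is the Green function of
-- the Laplacian grounded at q.  Write s and s′ for the numbers of trees using e in its two
-- directions towards q.  The same pairing applied to the trees through e evaluates the number M_e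
-- of two-forests that contain e and separate it from q:  κ M_e = (s + s′) N(x,x) - s²  for e = xy.
-- The component of F avoiding q has one more vertex than edges, so κ₂ = Σ_v N(v,v) - Σ_e M_e, and
-- κ κ₂ = Σ_e (s² - s s′ + s′²) ≥ ¼ Σ_e (s + s′)².  Since Σ_e (s + s′) = (|V| - 1) κ, the theorem
-- follows from the Cauchy–Schwarz inequality.
module Submission where

open import Defs
open import Data.Bool using (true; false; not; if_then_else_)
open import Data.Bool.Properties using (not-involutive)
open import Data.Fin using (Fin; zero; suc; _≟_; fromℕ<)
open import Data.Fin.Subset using (Subset; _∈_; inside; outside)
open import Data.Fin.Subset.Properties using (_∈?_)
open import Data.Integer.Tactic.RingSolver using (solve-∀)
open import Data.List using (List; []; _∷_; length; map; filter; allFin)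
open import Data.List.Membership.Propositional.Properties using (∈-allFin; ∈-filter⁺; ∈-filter⁻; ∈-map⁺; ∈-map⁻)
open import Data.List.Membership.Propositional.Properties.WithK using (unique∧set⇒bag)
open import Data.List.Properties using (map-tabulate; length-tabulate)
open import Data.List.Relation.Binary.BagAndSetEquality using (∼bag⇒↭)
open import Data.List.Relation.Binary.Permutation.Propositional using (_↭_; prep)
open import Data.List.Relation.Unary.All using (All; []; _∷_)
open import Data.List.Relation.Unary.All.Properties using (¬Any⇒All¬)
open import Data.List.Relation.Unary.Any using (here; there)
open import Data.List.Relation.Unary.Unique.Propositional using (Unique; []; _∷_)
open import Data.List.Relation.Unary.Unique.Propositional.Properties using (filter⁺; map⁺)
open import Data.Nat using (ℕ)
open import Data.Nat.Tactic.RingSolver using () renaming (solve-∀ to ℕ-solve-∀)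
open import Data.Product using (_×_; _,_; proj₁; proj₂; ∃-syntax)
open import Data.Sum using (_⊎_; inj₁; inj₂)
open import Data.Vec using (lookup; updateAt; _[_]≔_)
open import Data.Vec.Properties using (lookup⇒[]=; []=⇒lookup; lookup∘update; lookup∘update′; []≔-minimal; []≔-updates; []≔-idempotent; []≔-lookup; updateAt-updateAt; updateAt-id-local; updateAt-cong-local)
open import Function using (_∘_; id)
open import Function.Bundles using (mk⇔)
open import Relation.Binary.PropositionalEquality using (_≡_; _≢_; refl; sym; trans; cong; cong₂; subst; subst₂; module ≡-Reasoning)
open import Relation.Nullary using (¬_; Dec; yes; no; does; contradiction; ¬?)
open import Relation.Nullary.Decidable using (map′; _×-dec_; _⊎-dec_)
import Data.Integer as ℤ
import Data.Integer.Properties as ℤₚ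
import Data.List.Membership.Propositional as List
import Data.List.Relation.Binary.Permutation.Propositional as Perm
import Data.List.Relation.Unary.Any as Any
import Data.Nat as ℕ
import Data.Nat.Properties as ℕₚ

-- Finite integer sums and the Cauchy-Schwarz inequality.

module Sums where

  open import Data.Integer using (ℤ; -[1+_]; +≤+; 0ℤ; 1ℤ; -1ℤ; _+_; _*_; _-_; _≤_)

  private
    variable
      A B : Set

  ∑ : List A → (A → ℤ) → ℤ
  ∑ []       f = 0ℤ
  ∑ (x ∷ xs) f = f x + ∑ xs f

  ∑-cong-∈ : ∀ (xs : List A) {f g : A → ℤ} → (∀ {x} → x List.∈ xs → f x ≡ g x) → ∑ xs f ≡ ∑ xs g
  ∑-cong-∈ []       eq = refl
  ∑-cong-∈ (x ∷ xs) eq = cong₂ _+_ (eq (here refl)) (∑-cong-∈ xs (eq ∘ there))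

  ∑-cong : ∀ (xs : List A) {f g : A → ℤ} → (∀ x → f x ≡ g x) → ∑ xs f ≡ ∑ xs g
  ∑-cong xs eq = ∑-cong-∈ xs (λ {x} _ → eq x)

  ∑-mono-∈ : ∀ (xs : List A) {f g : A → ℤ} → (∀ {x} → x List.∈ xs → f x ≤ g x) → ∑ xs f ≤ ∑ xs g
  ∑-mono-∈ []       le = ℤₚ.≤-refl
  ∑-mono-∈ (x ∷ xs) le = ℤₚ.+-mono-≤ (le (here refl)) (∑-mono-∈ xs (le ∘ there))

  ∑-zero : ∀ (xs : List A) → ∑ xs (λ _ → 0ℤ) ≡ 0ℤ
  ∑-zero []       = refl
  ∑-zero (x ∷ xs) = trans (ℤₚ.+-identityˡ _) (∑-zero xs)

  ∑-one : ∀ (xs : List A) → ∑ xs (λ _ → 1ℤ) ≡ ℤ.+ length xs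
  ∑-one []       = refl
  ∑-one (x ∷ xs) = cong (1ℤ +_) (∑-one xs)

  +-interchange : ∀ a b c d → (a + b) + (c + d) ≡ (a + c) + (b + d)
  +-interchange = solve-∀

  ∑-+ : ∀ (xs : List A) (f g : A → ℤ) → ∑ xs (λ x → f x + g x) ≡ ∑ xs f + ∑ xs g
  ∑-+ []       f g = refl
  ∑-+ (x ∷ xs) f g = trans (cong (f x + g x +_) (∑-+ xs f g)) (+-interchange (f x) (g x) (∑ xs f) (∑ xs g))

  ∑-*ˡ : ∀ c (xs : List A) (f : A → ℤ) → ∑ xs (λ x → c * f x) ≡ c * ∑ xs f
  ∑-*ˡ c []       f = sym (ℤₚ.*-zeroʳ c)
  ∑-*ˡ c (x ∷ xs) f = trans (cong (c * f x +_) (∑-*ˡ c xs f)) (sym (ℤₚ.*-distribˡ-+ c (f x) (∑ xs f)))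

  ∑-*ʳ : ∀ c (xs : List A) (f : A → ℤ) → ∑ xs (λ x → f x * c) ≡ ∑ xs f * c
  ∑-*ʳ c xs f = trans (∑-cong xs (λ x → ℤₚ.*-comm (f x) c)) (trans (∑-*ˡ c xs f) (ℤₚ.*-comm c (∑ xs f)))

  ∑-- : ∀ (xs : List A) (f g : A → ℤ) → ∑ xs (λ x → f x - g x) ≡ ∑ xs f - ∑ xs g
  ∑-- xs f g = trans (∑-cong xs (λ x → neg (f x) (g x)))
    (trans (∑-+ xs f (λ x → -1ℤ * g x))
    (trans (cong (∑ xs f +_) (∑-*ˡ -1ℤ xs g)) (sym (neg (∑ xs f) (∑ xs g)))))
    where
    neg : ∀ a b → a - b ≡ a + -1ℤ * b
    neg = solve-∀

  ∑-swap : ∀ (xs : List A) (ys : List B) (f : A → B → ℤ) →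
    ∑ xs (λ x → ∑ ys (f x)) ≡ ∑ ys (λ y → ∑ xs (λ x → f x y))
  ∑-swap []       ys f = sym (∑-zero ys)
  ∑-swap (x ∷ xs) ys f = trans (cong (∑ ys (f x) +_) (∑-swap xs ys f)) (sym (∑-+ ys (f x) (λ y → ∑ xs (λ x → f x y))))

  ∑-map : ∀ (g : A → B) xs (f : B → ℤ) → ∑ (map g xs) f ≡ ∑ xs (f ∘ g)
  ∑-map g []       f = refl
  ∑-map g (x ∷ xs) f = cong (f (g x) +_) (∑-map g xs f)

  ∑-filter : ∀ {P : A → Set} (P? : ∀ x → Dec (P x)) xs (f : A → ℤ) →
    (∀ {x} → x List.∈ xs → ¬ P x → f x ≡ 0ℤ) → ∑ (filter P? xs) f ≡ ∑ xs f
  ∑-filter P? []       f z = refl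
  ∑-filter P? (x ∷ xs) f z with P? x
  ... | yes _ = cong (f x +_) (∑-filter P? xs f (z ∘ there))
  ... | no ¬p = trans (∑-filter P? xs f (z ∘ there))
    (sym (trans (cong (_+ ∑ xs f) (z (here refl) ¬p)) (ℤₚ.+-identityˡ _)))

  ∑-↭ : ∀ {xs ys : List A} (f : A → ℤ) → xs ↭ ys → ∑ xs f ≡ ∑ ys f
  ∑-↭ f Perm.refl        = refl
  ∑-↭ f (prep x p)       = cong (f x +_) (∑-↭ f p)
  ∑-↭ f (Perm.swap x y p) = trans (cong (λ s → f x + (f y + s)) (∑-↭ f p)) (exchange (f x) (f y) _)
    where
    exchange : ∀ a b c → a + (b + c) ≡ b + (a + c)
    exchange = solve-∀
  ∑-↭ f (Perm.trans p q) = trans (∑-↭ f p) (∑-↭ f q)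

  ∑-allFin-suc : ∀ {k} (f : Fin (ℕ.suc k) → ℤ) → ∑ (allFin (ℕ.suc k)) f ≡ f zero + ∑ (allFin k) (f ∘ suc)
  ∑-allFin-suc {k} f = cong (f zero +_)
    (trans (cong (λ xs → ∑ xs f) (sym (map-tabulate {n = k} id suc))) (∑-map suc (allFin k) f))

  δ : ∀ {k} → Fin k → Fin k → ℤ
  δ i j = if does (i ≟ j) then 1ℤ else 0ℤ

  δ-refl : ∀ {k} (i : Fin k) → δ i i ≡ 1ℤ
  δ-refl i with i ≟ i
  ... | yes _  = refl
  ... | no i≢i = contradiction refl i≢i

  ∑-δ : ∀ {k} (i : Fin k) (f : Fin k → ℤ) → ∑ (allFin k) (λ j → δ i j * f j) ≡ f i
  ∑-δ {ℕ.suc k} zero f = begin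
    ∑ (allFin (ℕ.suc k)) (λ j → δ zero j * f j)     ≡⟨ ∑-allFin-suc (λ j → δ zero j * f j) ⟩
    1ℤ * f zero + ∑ (allFin k) (λ _ → 0ℤ)           ≡⟨ cong (1ℤ * f zero +_) (∑-zero (allFin k)) ⟩
    1ℤ * f zero + 0ℤ                                ≡⟨ trans (ℤₚ.+-identityʳ _) (ℤₚ.*-identityˡ _) ⟩
    f zero                                          ∎
    where open ≡-Reasoning
  ∑-δ {ℕ.suc k} (suc i) f =
    trans (∑-allFin-suc (λ j → δ (suc i) j * f j)) (trans (ℤₚ.+-identityˡ _)
    (∑-δ i (f ∘ suc)))

  0≤i*i : ∀ i → 0ℤ ≤ i * i
  0≤i*i (ℤ.+ k)    = subst (0ℤ ≤_) (ℤₚ.pos-* k k) (+≤+ ℕ.z≤n)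
  0≤i*i (-[1+ k ]) = +≤+ ℕ.z≤n

  -- Induction on the list: twice the product of the new entry with a tail entry is at most the sum
  -- of their squares, so the cross terms cost one square of the new entry per tail entry.
  cauchy-schwarz : ∀ (xs : List A) (f : A → ℤ) →
    ∑ xs f * ∑ xs f ≤ ℤ.+ length xs * ∑ xs (λ x → f x * f x)
  cauchy-schwarz [] f = ℤₚ.≤-refl
  cauchy-schwarz (x ∷ xs) f = ℤₚ.≤-trans
    (ℤₚ.≤-trans (ℤₚ.≤-reflexive (expand (f x) s)) (ℤₚ.+-mono-≤ cross (cauchy-schwarz xs f)))
    (ℤₚ.≤-reflexive (collect (f x) l u))
    where
    s = ∑ xs f
    u = ∑ xs (λ y → f y * f y)
    l = ℤ.+ length xs
    two : ∀ (ys : List _) → ℤ.+ 2 * (f x * ∑ ys f) ≤ ℤ.+ length ys * (f x * f x) + ∑ ys (λ y → f y * f y)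
    two [] = ℤₚ.≤-reflexive (cong (ℤ.+ 2 *_) (ℤₚ.*-zeroʳ (f x)))
    two (y ∷ ys) = ℤₚ.≤-trans (ℤₚ.≤-reflexive (d₁ (f x) (f y) (∑ ys f)))
      (ℤₚ.≤-trans (ℤₚ.+-mono-≤ (amgm (f x) (f y)) (two ys)) (ℤₚ.≤-reflexive (d₂ (f x) (f y) (ℤ.+ length ys) _)))
      where
      d₁ : ∀ a b c → ℤ.+ 2 * (a * (b + c)) ≡ ℤ.+ 2 * (a * b) + ℤ.+ 2 * (a * c)
      d₁ = solve-∀
      d₂ : ∀ a b n v → (a * a + b * b) + (n * (a * a) + v) ≡ (1ℤ + n) * (a * a) + (b * b + v)
      d₂ = solve-∀
      amgm : ∀ a b → ℤ.+ 2 * (a * b) ≤ a * a + b * b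
      amgm a b = ℤₚ.0≤i-j⇒j≤i (subst (0ℤ ≤_) (sq a b) (0≤i*i (a - b)))
        where
        sq : ∀ a b → (a - b) * (a - b) ≡ a * a + b * b - ℤ.+ 2 * (a * b)
        sq = solve-∀
    cross : f x * f x + ℤ.+ 2 * (f x * s) ≤ f x * f x + (l * (f x * f x) + u)
    cross = ℤₚ.+-monoʳ-≤ (f x * f x) (two xs)
    expand : ∀ a s → (a + s) * (a + s) ≡ (a * a + ℤ.+ 2 * (a * s)) + s * s
    expand = solve-∀
    collect : ∀ a l u → (a * a + (l * (a * a) + u)) + l * u ≡ (1ℤ + l) * (a * a + u)
    collect = solve-∀

-- Connectivity within a set of edges, and its decidability.

module Connectivity (G : Multigraph) where

  private
    V = Fin (n G)
    E = Fin (m G)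

  src tgt : E → V
  src f = proj₁ (ends G f)
  tgt f = proj₂ (ends G f)

  _∪₁_ _∖_ : Subset (m G) → E → Subset (m G)
  S ∪₁ f = S [ f ]≔ inside
  S ∖ f = S [ f ]≔ outside

  private
    variable
      S : Subset (m G)
      e f : E
      u v w x : V

  outside≢inside : outside ≢ inside
  outside≢inside ()

  f∉S∖f : ¬ f ∈ S ∖ f
  f∉S∖f {f} {S} f∈ = outside≢inside (trans (sym (lookup∘update f S outside)) ([]=⇒lookup f∈))

  ∈-∖⁺ : e ≢ f → e ∈ S → e ∈ S ∖ f
  ∈-∖⁺ {e} {f} {S} e≢f e∈S = []≔-minimal S e f e≢f e∈S

  ∈-∖⁻ : e ∈ S ∖ f → e ∈ S
  ∈-∖⁻ {e} {S} {f} e∈ with e ≟ f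
  ... | yes refl = contradiction e∈ (f∉S∖f {S = S})
  ... | no e≢f   = lookup⇒[]= e S (trans (sym (lookup∘update′ e≢f S outside)) ([]=⇒lookup e∈))

  ∈-∪₁⁻ : e ≢ f → e ∈ S ∪₁ f → e ∈ S
  ∈-∪₁⁻ {e} {f} {S} e≢f e∈ = lookup⇒[]= e S (trans (sym (lookup∘update′ e≢f S inside)) ([]=⇒lookup e∈))

  ∉⇒outside : ¬ f ∈ S → lookup S f ≡ outside
  ∉⇒outside {f} {S} f∉ with lookup S f in eq
  ... | false = refl
  ... | true  = contradiction (lookup⇒[]= f S eq) f∉

  ∪₁-∖ : ¬ f ∈ S → (S ∪₁ f) ∖ f ≡ S
  ∪₁-∖ {f} {S} f∉S = trans ([]≔-idempotent S f)
    (trans (cong (S [ f ]≔_) (sym (∉⇒outside f∉S))) ([]≔-lookup S f))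

  connected-refl : Connected G S u u
  connected-refl = [] , nil

  connected-trans : Connected G S u v → Connected G S v w → Connected G S u w
  connected-trans (_ , nil)        q = q
  connected-trans (_ , cons i j p) q with _ , r ← connected-trans (_ , p) q = _ , cons i j r

  joins-sym : Joins G e u v → Joins G e v u
  joins-sym (inj₁ eq) = inj₂ eq
  joins-sym (inj₂ eq) = inj₁ eq

  connected-step : e ∈ S → Joins G e u v → Connected G S u v
  connected-step i j = _ , cons i j nil

  connected-sym : Connected G S u v → Connected G S v u
  connected-sym (_ , nil)        = connected-refl
  connected-sym (_ , cons i j p) = connected-trans (connected-sym (_ , p)) (connected-step i (joins-sym j))

  connected-edge : f ∈ S → Connected G S (src f) (tgt f)
  connected-edge i = connected-step i (inj₁ refl)

  connected-mono : ∀ {S′} → (∀ {e} → e ∈ S → e ∈ S′) → Connected G S u v → Connected G S′ u v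
  connected-mono sub (_ , nil)        = connected-refl
  connected-mono sub (_ , cons i j p) = connected-trans (connected-step (sub i) j) (connected-mono sub (_ , p))

  -- Connection by a walk that passes through `f` at most once, in either direction, and otherwise
  -- stays in `S`. Applied to `S ∖ f`, it reduces connectivity in `S` to connectivity in a smaller
  -- set.
  Via : E → Subset (m G) → V → V → Set
  Via f S u v = Connected G S u v ⊎
    (Connected G S u (src f) × Connected G S (tgt f) v) ⊎
    (Connected G S u (tgt f) × Connected G S (src f) v)

  connected-∖⁻ : ∀ f → Connected G S u v → Via f (S ∖ f) u v
  connected-∖⁻ f (_ , nil) = inj₁ connected-refl
  connected-∖⁻ f (_ , cons {e = e} i j p) with e ≟ f | connected-∖⁻ f (_ , p)
  ... | no e≢f | inj₁ c              = inj₁ (connected-trans (connected-step (∈-∖⁺ e≢f i) j) c)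
  ... | no e≢f | inj₂ (inj₁ (c , d)) = inj₂ (inj₁ (connected-trans (connected-step (∈-∖⁺ e≢f i) j) c , d))
  ... | no e≢f | inj₂ (inj₂ (c , d)) = inj₂ (inj₂ (connected-trans (connected-step (∈-∖⁺ e≢f i) j) c , d))
  -- The walk now starts at an endpoint of `f`. If the rest passes `f` again, everything before that
  -- passage is dropped: a passage in the same direction replaces the first, and a passage back
  -- cancels it.
  connected-∖⁻ f (_ , cons i (inj₁ refl) p) | yes refl | inj₁ c              = inj₂ (inj₁ (connected-refl , c))
  connected-∖⁻ f (_ , cons i (inj₁ refl) p) | yes refl | inj₂ (inj₁ (c , d)) = inj₂ (inj₁ (connected-refl , d))
  connected-∖⁻ f (_ , cons i (inj₁ refl) p) | yes refl | inj₂ (inj₂ (c , d)) = inj₁ d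
  connected-∖⁻ f (_ , cons i (inj₂ refl) p) | yes refl | inj₁ c              = inj₂ (inj₂ (connected-refl , c))
  connected-∖⁻ f (_ , cons i (inj₂ refl) p) | yes refl | inj₂ (inj₁ (c , d)) = inj₁ d
  connected-∖⁻ f (_ , cons i (inj₂ refl) p) | yes refl | inj₂ (inj₂ (c , d)) = inj₂ (inj₂ (connected-refl , d))

  connected-∖⁺ : f ∈ S → Via f (S ∖ f) u v → Connected G S u v
  connected-∖⁺ i (inj₁ c)              = connected-mono ∈-∖⁻ c
  connected-∖⁺ i (inj₂ (inj₁ (c , d))) =
    connected-trans (connected-mono ∈-∖⁻ c) (connected-trans (connected-edge i) (connected-mono ∈-∖⁻ d))
  connected-∖⁺ i (inj₂ (inj₂ (c , d))) =
    connected-trans (connected-mono ∈-∖⁻ c) (connected-trans (connected-sym (connected-edge i)) (connected-mono ∈-∖⁻ d))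

  -- Edges are deleted one by one, and `Via` accounts for each deleted edge. The list `es` covers
  -- the edges still present and makes the recursion terminate.
  connected-within? : ∀ (es : List E) S → (∀ {e} → e ∈ S → e List.∈ es) → ∀ u v → Dec (Connected G S u v)
  connected-within? [] S sub u v with u ≟ v
  ... | yes refl = yes connected-refl
  ... | no u≢v   = no λ { (_ , nil) → u≢v refl ; (_ , cons i _ _) → contradiction (sub i) λ () }
  connected-within? (f ∷ es) S sub u v with f ∈? S
  ... | yes f∈S = map′ (connected-∖⁺ f∈S) (connected-∖⁻ f)
    (rec u v ⊎-dec (rec u (src f) ×-dec rec (tgt f) v) ⊎-dec (rec u (tgt f) ×-dec rec (src f) v))
    where
    sub′ : ∀ {e} → e ∈ S ∖ f → e List.∈ es
    sub′ i with sub (∈-∖⁻ i)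
    ... | here refl = contradiction i (f∉S∖f {S = S})
    ... | there p   = p
    rec : ∀ u v → Dec (Connected G (S ∖ f) u v)
    rec = connected-within? es (S ∖ f) sub′
  ... | no f∉S = connected-within? es S sub′ u v
    where
    sub′ : ∀ {e} → e ∈ S → e List.∈ es
    sub′ i with sub i
    ... | here refl = contradiction i f∉S
    ... | there p   = p

  connected? : ∀ S u v → Dec (Connected G S u v)
  connected? S = connected-within? (allFin (m G)) S (λ _ → ∈-allFin _)

  -- Trails, and acyclicity as the property that every edge is a bridge.

  Trail : Subset (m G) → V → V → Set
  Trail S u v = ∃[ es ] Walk G S u v es × Unique es

  joins-endpoint : ∀ {a b c d} → Joins G e a b → Joins G e c d → a ≡ c ⊎ a ≡ d
  joins-endpoint (inj₁ p) (inj₁ q) = inj₁ (cong proj₁ (trans (sym p) q))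
  joins-endpoint (inj₁ p) (inj₂ q) = inj₂ (cong proj₁ (trans (sym p) q))
  joins-endpoint (inj₂ p) (inj₁ q) = inj₂ (cong proj₂ (trans (sym p) q))
  joins-endpoint (inj₂ p) (inj₂ q) = inj₁ (cong proj₂ (trans (sym p) q))

  -- A trail that already uses e passes through both of its endpoints, so it can be started at either.
  shortcut : ∀ {es} → Joins G e u w → Walk G S v x es → Unique es → e List.∈ es → Trail S u x
  shortcut j (cons i k p) (e∉ ∷ uniq) (here refl) with joins-endpoint j k
  ... | inj₁ refl = _ , cons i k p , e∉ ∷ uniq
  ... | inj₂ refl = _ , p , uniq
  shortcut j (cons i k p) (_ ∷ uniq) (there e∈) = shortcut j p uniq e∈

  connected⇒trail : Connected G S u v → Trail S u v
  connected⇒trail (_ , nil) = [] , nil , []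
  connected⇒trail (_ , cons {e = e} i j p) with connected⇒trail (_ , p)
  ... | es , q , uniq with Any.any? (e ≟_) es
  ...   | yes e∈ = shortcut j q uniq e∈
  ...   | no e∉  = e ∷ es , cons i j q , ¬Any⇒All¬ es e∉ ∷ uniq

  walk-edges : ∀ {es} → Walk G S u v es → All (_∈ S) es
  walk-edges nil          = []
  walk-edges (cons i _ p) = i ∷ walk-edges p

  -- A trail joining the endpoints of `f` without `f` closes up with `f` to a cycle. With the
  -- converse `cut⇒acyclic`, this lets the exchange arguments speak of connectivity instead of
  -- cycles.
  acyclic⇒cut : Acyclic G S → f ∈ S → ¬ Connected G (S ∖ f) (src f) (tgt f)
  acyclic⇒cut {S} {f} ac f∈S c with es , p , uniq ← connected⇒trail (connected-sym c) =
    ac (src f , f , es , cons f∈S (inj₁ refl) (weaken p) , fresh (walk-edges p) ∷ uniq)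
    where
    weaken : ∀ {u v es} → Walk G (S ∖ f) u v es → Walk G S u v es
    weaken nil          = nil
    weaken (cons i j q) = cons (∈-∖⁻ i) j (weaken q)
    fresh : ∀ {es} → All (_∈ S ∖ f) es → All (f ≢_) es
    fresh []       = []
    fresh (i ∷ is) = (λ { refl → f∉S∖f {S = S} i }) ∷ fresh is

  -- The first edge of a cycle does not recur in it, so the rest of the cycle joins its endpoints
  -- without it.
  cut⇒acyclic : (∀ f → f ∈ S → ¬ Connected G (S ∖ f) (src f) (tgt f)) → Acyclic G S
  cut⇒acyclic {S} cut (_ , f , es , cons f∈S j p , f∉ ∷ _) = cut f f∈S (orient j (avoid p f∉))
    where
    avoid : ∀ {u v es} → Walk G S u v es → All (f ≢_) es → Connected G (S ∖ f) u v
    avoid nil          []          = connected-refl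
    avoid (cons i k q) (f≢e ∷ f∉) = connected-trans (connected-step (∈-∖⁺ (f≢e ∘ sym) i) k) (avoid q f∉)
    orient : ∀ {u w} → Joins G f u w → Connected G (S ∖ f) w u → Connected G (S ∖ f) (src f) (tgt f)
    orient (inj₁ refl) c = connected-sym c
    orient (inj₂ refl) c = c

  acyclic-∖ : Acyclic G S → Acyclic G (S ∖ f)
  acyclic-∖ {S} {f} ac = cut⇒acyclic λ g g∈ c →
    acyclic⇒cut ac (∈-∖⁻ g∈) (connected-mono (λ {e} e∈ → keep g e∈) c)
    where
    keep : ∀ g {e} → e ∈ (S ∖ f) ∖ g → e ∈ S ∖ g
    keep g {e} e∈ with e ≟ g
    ... | yes refl = contradiction e∈ (f∉S∖f {S = S ∖ f})
    ... | no e≢g   = ∈-∖⁺ e≢g (∈-∖⁻ (∈-∖⁻ e∈))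

  -- Exchange of one edge between spanning trees and two-forests.

  tree∖edge : ∀ {T} → IsSpanningTree G T → f ∈ T → IsTwoForest G (T ∖ f)
  tree∖edge {f} {T} (ac , conn) f∈T = acyclic-∖ ac , src f , tgt f , acyclic⇒cut ac f∈T , side
    where
    side : ∀ v → Connected G (T ∖ f) (src f) v ⊎ Connected G (T ∖ f) (tgt f) v
    side v with connected-∖⁻ f (conn (src f) v)
    ... | inj₁ c              = inj₁ c
    ... | inj₂ (inj₁ (_ , c)) = inj₂ c
    ... | inj₂ (inj₂ (_ , c)) = inj₁ c

  -- Suppose that the endpoints of an edge `g` other than `f` are joined without `g`. If `f` is
  -- avoided as well, `g` is not a bridge of `S`; if `f` is used, the two remaining pieces and `g`
  -- join the endpoints of `f` inside `S`.
  acyclic-∪₁ : Acyclic G S → ¬ Connected G S (src f) (tgt f) → Acyclic G (S ∪₁ f)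
  acyclic-∪₁ {S} {f} ac ncut = cut⇒acyclic cut
    where
    f∉S : ¬ f ∈ S
    f∉S i = ncut (connected-edge i)
    cut : ∀ g → g ∈ S ∪₁ f → ¬ Connected G ((S ∪₁ f) ∖ g) (src g) (tgt g)
    cut g g∈ c with g ≟ f
    ... | yes refl = ncut (subst (λ R → Connected G R (src g) (tgt g)) (∪₁-∖ f∉S) c)
    ... | no g≢f   = go (connected-∖⁻ f c)
      where
      g∈S : g ∈ S
      g∈S = ∈-∪₁⁻ g≢f g∈
      sub : ∀ {e} → e ∈ ((S ∪₁ f) ∖ g) ∖ f → e ∈ S ∖ g
      sub {e} e∈ with e ≟ f | e ≟ g
      ... | yes refl | _        = contradiction e∈ (f∉S∖f {S = (S ∪₁ f) ∖ g})
      ... | no _     | yes refl = contradiction (∈-∖⁻ e∈) (f∉S∖f {S = S ∪₁ f})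
      ... | no e≢f   | no e≢g   = ∈-∖⁺ e≢g (∈-∪₁⁻ e≢f (∈-∖⁻ (∈-∖⁻ e∈)))
      inS : ∀ {a b} → Connected G (((S ∪₁ f) ∖ g) ∖ f) a b → Connected G S a b
      inS = connected-mono (∈-∖⁻ ∘ sub)
      go : ¬ Via f (((S ∪₁ f) ∖ g) ∖ f) (src g) (tgt g)
      go (inj₁ d)              = acyclic⇒cut ac g∈S (connected-mono sub d)
      go (inj₂ (inj₁ (d , d′))) = ncut (connected-trans (connected-sym (inS d))
        (connected-trans (connected-edge g∈S) (connected-sym (inS d′))))
      go (inj₂ (inj₂ (d , d′))) = ncut (connected-trans (inS d′)
        (connected-trans (connected-sym (connected-edge g∈S)) (inS d)))

  forest∪edge : ∀ {F} → IsTwoForest G F → ¬ Connected G F (src f) (tgt f) → IsSpanningTree G (F ∪₁ f)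
  forest∪edge {f} {F} (ac , a , b , _ , side) ncut = acyclic-∪₁ ac ncut , λ u v → connected-trans (toA u) (connected-sym (toA v))
    where
    up : ∀ {u v} → Connected G F u v → Connected G (F ∪₁ f) u v
    up = connected-mono λ {e} e∈ → grow e e∈
      where
      grow : ∀ e → e ∈ F → e ∈ F ∪₁ f
      grow e e∈ with e ≟ f
      ... | yes refl = []≔-updates F f
      ... | no e≢f   = []≔-minimal F e f e≢f e∈
    bridge : Connected G (F ∪₁ f) (src f) (tgt f)
    bridge = connected-edge ([]≔-updates F f)
    -- The endpoints of `f` are not connected in `F`, so one lies on each side and `f` links the two
    -- sides.
    b~a : Connected G (F ∪₁ f) b a
    b~a with side (src f) | side (tgt f)
    ... | inj₁ c | inj₁ d = contradiction (connected-trans (connected-sym c) d) ncut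
    ... | inj₂ c | inj₂ d = contradiction (connected-trans (connected-sym c) d) ncut
    ... | inj₁ c | inj₂ d = connected-sym (connected-trans (up c) (connected-trans bridge (connected-sym (up d))))
    ... | inj₂ c | inj₁ d = connected-trans (up c) (connected-trans bridge (connected-sym (up d)))
    toA : ∀ v → Connected G (F ∪₁ f) v a
    toA v with side v
    ... | inj₁ c = connected-sym (up c)
    ... | inj₂ c = connected-trans (connected-sym (up c)) b~a

-- Unit flows along the paths of a forest.

module Flows (G : Multigraph) where

  open Sums
  open Connectivity G
  open import Data.Integer using (ℤ; +≤+; 0ℤ; 1ℤ; _+_; _*_; _-_; _≤_)

  private
    V = Fin (n G)
    E = Fin (m G)
    variable
      S : Subset (m G)
      f : E
      u v w ρ : V

  vertices : List V
  vertices = allFin (n G)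

  edges : List E
  edges = allFin (m G)

  member : Subset (m G) → E → ℤ
  member S f = if lookup S f then 1ℤ else 0ℤ

  member-∈ : f ∈ S → member S f ≡ 1ℤ
  member-∈ f∈S = cong (if_then 1ℤ else 0ℤ) ([]=⇒lookup f∈S)

  member-∉ : ¬ f ∈ S → member S f ≡ 0ℤ
  member-∉ f∉S = cong (if_then 1ℤ else 0ℤ) (∉⇒outside f∉S)

  member-idem : ∀ S f → member S f * member S f ≡ member S f
  member-idem S f with lookup S f
  ... | true  = refl
  ... | false = refl

  -- The indicator a_F of the overview, with a variable root: besides `q`, a root is also taken
  -- inside the component of a two-forest that avoids `q`.
  away : V → Subset (m G) → V → ℤ
  away ρ S v = if does (connected? S v ρ) then 0ℤ else 1ℤ

  away-connected : Connected G S v ρ → away ρ S v ≡ 0ℤ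
  away-connected {S} {v} {ρ} c with connected? S v ρ
  ... | yes _ = refl
  ... | no ¬c = contradiction c ¬c

  away-disconnected : ¬ Connected G S v ρ → away ρ S v ≡ 1ℤ
  away-disconnected {S} {v} {ρ} ¬c with connected? S v ρ
  ... | yes c = contradiction c ¬c
  ... | no _  = refl

  away-cong : ∀ ρ → Connected G S u v → away ρ S u ≡ away ρ S v
  away-cong {S} {u} {v} ρ c with connected? S v ρ
  ... | yes d = away-connected (connected-trans c d)
  ... | no ¬d = away-disconnected (λ d → ¬d (connected-trans (connected-sym c) d))

  away-idem : ∀ ρ S v → away ρ S v * away ρ S v ≡ away ρ S v
  away-idem ρ S v with connected? S v ρ
  ... | yes _ = refl
  ... | no _  = refl

  ∂ : (V → ℤ) → E → ℤ
  ∂ φ f = φ (src f) - φ (tgt f)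

  -- Deleting the bridge `f` leaves exactly one of its endpoints connected to `ρ`.
  ∂away²-cut : Acyclic G S → f ∈ S → Connected G S (src f) ρ →
    ∂ (away ρ (S ∖ f)) f * ∂ (away ρ (S ∖ f)) f ≡ 1ℤ
  ∂away²-cut {S} {f} {ρ} ac f∈S c with connected-∖⁻ f c
  ... | inj₁ s~ρ rewrite away-connected s~ρ
      | away-disconnected {S ∖ f} {tgt f} (λ t~ρ → acyclic⇒cut ac f∈S (connected-trans s~ρ (connected-sym t~ρ))) = refl
  ... | inj₂ (inj₁ (_ , t~ρ)) rewrite away-connected t~ρ
      | away-disconnected {S ∖ f} {src f} (λ s~ρ → acyclic⇒cut ac f∈S (connected-trans s~ρ (connected-sym t~ρ))) = refl
  ... | inj₂ (inj₂ (s~t , _)) = contradiction s~t (acyclic⇒cut ac f∈S)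

  -- An edge `f` of a tree lies on the path from `w` to `ρ` exactly when its removal separates `w`
  -- from `ρ`; the endpoint cut off from `ρ` then gives the direction of the flow as the sign of the
  -- last factor.
  flow : V → Subset (m G) → V → E → ℤ
  flow ρ S w f = member S f * (away ρ (S ∖ f) w * ∂ (away ρ (S ∖ f)) f)

  -- flow ρ S w is the unit flow along the path of the forest S from w to ρ.  Moving w across an
  -- edge g changes away ρ (S ∖ f) w only for f = g, so the sum telescopes along any walk to ρ.
  flow-telescope : Acyclic G S → Connected G S w ρ → ∀ φ →
    ∑ edges (λ f → flow ρ S w f * ∂ φ f) ≡ φ w - φ ρ
  flow-telescope {S} {ρ = ρ} ac (_ , nil) φ = trans
    (trans (∑-cong edges stay) (∑-zero edges)) (sym (ℤₚ.+-inverseʳ (φ ρ)))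
    where
    zero-flow : ∀ a b c → a * (0ℤ * b) * c ≡ 0ℤ
    zero-flow = solve-∀
    stay : ∀ f → flow ρ S ρ f * ∂ φ f ≡ 0ℤ
    stay f rewrite away-connected {S ∖ f} {ρ} connected-refl = zero-flow (member S f) (∂ (away ρ (S ∖ f)) f) (∂ φ f)
  flow-telescope {S} {w} {ρ} ac (_ , cons {w = w′} {e = g} g∈S j p) φ = begin
    ∑ edges (λ f → flow ρ S w f * ∂ φ f)                                    ≡⟨ ∑-cong edges step ⟩
    ∑ edges (λ f → flow ρ S w′ f * ∂ φ f + δ g f * (φ w - φ w′))            ≡⟨ ∑-+ edges _ _ ⟩
    ∑ edges (λ f → flow ρ S w′ f * ∂ φ f) + ∑ edges (λ f → δ g f * (φ w - φ w′))
      ≡⟨ cong₂ _+_ (flow-telescope ac (_ , p) φ) (∑-δ g (λ _ → φ w - φ w′)) ⟩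
    (φ w′ - φ ρ) + (φ w - φ w′)                                             ≡⟨ tele (φ w) (φ w′) (φ ρ) ⟩
    φ w - φ ρ                                                               ∎
    where
    open ≡-Reasoning
    tele : ∀ a b c → (b - c) + (a - b) ≡ a - c
    tele = solve-∀
    add-zero : ∀ a b → a ≡ a + 0ℤ * b
    add-zero = solve-∀
    cross₁ : ∀ a b e → 1ℤ * (a * (a - b)) * e ≡ 1ℤ * (b * (a - b)) * e + ((a - b) * (a - b)) * e
    cross₁ = solve-∀
    cross₂ : ∀ a b c d → 1ℤ * (a * (b - a)) * (d - c) ≡ 1ℤ * (b * (b - a)) * (d - c) + ((b - a) * (b - a)) * (c - d)
    cross₂ = solve-∀
    -- The case `f` = `g`. The flows from the two ends of `g` differ by the square of
    -- `∂ (away ρ (S ∖ g)) g`, which is 1, up to a sign that matches the orientation of `∂ φ g`.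
    crossing : ∀ {w w′} → Joins G g w w′ → Connected G S w′ ρ →
      1ℤ * (away ρ (S ∖ g) w * ∂ (away ρ (S ∖ g)) g) * ∂ φ g ≡
      1ℤ * (away ρ (S ∖ g) w′ * ∂ (away ρ (S ∖ g)) g) * ∂ φ g + 1ℤ * (φ w - φ w′)
    crossing (inj₁ refl) c = trans (cross₁ (away ρ (S ∖ g) (src g)) (away ρ (S ∖ g) (tgt g)) (∂ φ g))
      (cong (λ z → 1ℤ * (away ρ (S ∖ g) (tgt g) * ∂ (away ρ (S ∖ g)) g) * ∂ φ g + z * ∂ φ g)
        (∂away²-cut ac g∈S (connected-trans (connected-edge g∈S) c)))
    crossing (inj₂ refl) c = trans (cross₂ (away ρ (S ∖ g) (tgt g)) (away ρ (S ∖ g) (src g)) (φ (tgt g)) (φ (src g)))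
      (cong (λ z → 1ℤ * (away ρ (S ∖ g) (src g) * ∂ (away ρ (S ∖ g)) g) * ∂ φ g + z * (φ (tgt g) - φ (src g)))
        (∂away²-cut ac g∈S c))
    step : ∀ f → flow ρ S w f * ∂ φ f ≡ flow ρ S w′ f * ∂ φ f + δ g f * (φ w - φ w′)
    step f with g ≟ f
    ... | no g≢f rewrite away-cong ρ (connected-step {S = S ∖ f} (∈-∖⁺ g≢f g∈S) j) =
      add-zero (flow ρ S w′ f * ∂ φ f) (φ w - φ w′)
    ... | yes refl rewrite member-∈ g∈S = crossing j (_ , p)

  member-∖ : ∀ S e f → member (S ∖ f) e ≡ member S e - δ e f * member S e
  member-∖ S e f with e ≟ f
  ... | yes refl = trans (member-∉ (f∉S∖f {S = S})) (vanish (member S e))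
    where
    vanish : ∀ a → 0ℤ ≡ a - 1ℤ * a
    vanish = solve-∀
  ... | no e≢f = trans (cong (if_then 1ℤ else 0ℤ) (lookup∘update′ e≢f S outside)) (keep (member S e))
    where
    keep : ∀ a → a ≡ a - 0ℤ * a
    keep = solve-∀

  -- Summation by parts: a sum over vertices tested against their indicators becomes a gradient
  -- along an edge.
  ∑-∂δ : ∀ f (h : V → ℤ) → ∑ vertices (λ v → ∂ (λ u → δ u v) f * h v) ≡ ∂ h f
  ∑-∂δ f h = begin
    ∑ vertices (λ v → (δ (src f) v - δ (tgt f) v) * h v)                ≡⟨ ∑-cong vertices (λ v → distrib (δ (src f) v) (δ (tgt f) v) (h v)) ⟩
    ∑ vertices (λ v → δ (src f) v * h v - δ (tgt f) v * h v)            ≡⟨ ∑-- vertices _ _ ⟩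
    ∑ vertices (λ v → δ (src f) v * h v) - ∑ vertices (λ v → δ (tgt f) v * h v)
      ≡⟨ cong₂ _-_ (∑-δ (src f) h) (∑-δ (tgt f) h) ⟩
    ∂ h f                                                               ∎
    where
    open ≡-Reasoning
    distrib : ∀ a b c → (a - b) * c ≡ a * c - b * c
    distrib = solve-∀

  ∂away²≤1 : ∀ ρ S f → ∂ (away ρ S) f * ∂ (away ρ S) f ≤ 1ℤ
  ∂away²≤1 ρ S f with connected? S (src f) ρ | connected? S (tgt f) ρ
  ... | yes _ | yes _ = +≤+ ℕ.z≤n
  ... | yes _ | no _  = ℤₚ.≤-refl
  ... | no _  | yes _ = ℤₚ.≤-refl
  ... | no _  | no _  = +≤+ ℕ.z≤n

  -- Of the two representatives of the components, `ρ` is the one not connected to `q`.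
  twoForest-root : ∀ {F} → IsTwoForest G F → ∀ q →
    ∃[ ρ ] (¬ Connected G F ρ q × (∀ v → ¬ Connected G F v q → Connected G F v ρ))
  twoForest-root (_ , a , b , ¬a~b , side) q with side q
  ... | inj₁ a~q = b , (λ b~q → ¬a~b (connected-trans a~q (connected-sym b~q))) , other
    where
    other : ∀ v → ¬ Connected G _ v q → Connected G _ v b
    other v ¬v~q with side v
    ... | inj₁ a~v = contradiction (connected-trans (connected-sym a~v) a~q) ¬v~q
    ... | inj₂ b~v = connected-sym b~v
  ... | inj₂ b~q = a , (λ a~q → ¬a~b (connected-trans a~q (connected-sym b~q))) , other
    where
    other : ∀ v → ¬ Connected G _ v q → Connected G _ v a
    other v ¬v~q with side v
    ... | inj₁ a~v = connected-sym a~v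
    ... | inj₂ b~v = contradiction (connected-trans (connected-sym b~v) b~q) ¬v~q

  -- Every vertex away from q other than the root ρ of its component sends one unit of flow
  -- through the first edge of its path to ρ, and these edges are distinct.
  away-vertices≤1+away-edges : ∀ {F} → IsTwoForest G F → ∀ q →
    ∑ vertices (away q F) ≤ 1ℤ + ∑ edges (λ f → member F f * away q F (src f))
  away-vertices≤1+away-edges {F} tf@(ac , _) q with ρ , ¬ρ~q , ~ρ ← twoForest-root tf q = begin
    ∑ vertices a                                                            ≡⟨ ∑-cong vertices split ⟩
    ∑ vertices (λ v → δ ρ v * a v + ∑ edges (λ f → ∂ (λ u → δ u v) f * (a v * flow ρ F v f)))
      ≡⟨ ∑-+ vertices _ _ ⟩
    ∑ vertices (λ v → δ ρ v * a v) + ∑ vertices (λ v → ∑ edges (λ f → ∂ (λ u → δ u v) f * (a v * flow ρ F v f)))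
      ≡⟨ cong₂ _+_ (trans (∑-δ ρ a) (away-disconnected ¬ρ~q)) (∑-swap vertices edges _) ⟩
    1ℤ + ∑ edges (λ f → ∑ vertices (λ v → ∂ (λ u → δ u v) f * (a v * flow ρ F v f)))
      ≡⟨ cong (1ℤ +_) (∑-cong edges (λ f → ∑-∂δ f (λ v → a v * flow ρ F v f))) ⟩
    1ℤ + ∑ edges (λ f → ∂ (λ v → a v * flow ρ F v f) f)
      ≤⟨ ℤₚ.+-monoʳ-≤ 1ℤ (∑-mono-∈ edges (λ {f} _ → bound f)) ⟩
    1ℤ + ∑ edges (λ f → member F f * a (src f))                             ∎
    where
    open ℤₚ.≤-Reasoning
    a : V → ℤ
    a = away q F
    vanish : ∀ d s → 0ℤ ≡ d * 0ℤ + 0ℤ * s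
    vanish = solve-∀
    collect : ∀ d → 1ℤ ≡ d * 1ℤ + 1ℤ * (1ℤ - d)
    collect = solve-∀
    commute : ∀ α x d → α * (x * d) ≡ d * (α * x)
    commute = solve-∀
    -- Paired with the indicator of `v`, the flow from `v` to `ρ` gives 1 - `δ ρ v`. The term
    -- `δ ρ v * a v` makes up for the root, and its sum is the 1 of the bound.
    factored : ∀ v → a v ≡ δ ρ v * a v + a v * ∑ edges (λ f → flow ρ F v f * ∂ (λ u → δ u v) f)
    factored v with connected? F v q
    ... | yes _ = vanish (δ ρ v) (∑ edges (λ f → flow ρ F v f * ∂ (λ u → δ u v) f))
    ... | no ¬v~q = trans (collect (δ ρ v)) (cong (λ s → δ ρ v * 1ℤ + 1ℤ * s)
      (sym (trans (flow-telescope ac (~ρ v ¬v~q) (λ u → δ u v)) (cong (_- δ ρ v) (δ-refl v)))))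
    split : ∀ v → a v ≡ δ ρ v * a v + ∑ edges (λ f → ∂ (λ u → δ u v) f * (a v * flow ρ F v f))
    split v = trans (factored v) (cong (δ ρ v * a v +_) (trans (sym (∑-*ˡ (a v) edges _))
      (∑-cong edges (λ f → commute (a v) (flow ρ F v f) (∂ (λ u → δ u v) f)))))
    square : ∀ α c c′ → α * (1ℤ * (c * (c - c′))) - α * (1ℤ * (c′ * (c - c′))) ≡ α * ((c - c′) * (c - c′))
    square = solve-∀
    annihilate : ∀ α β γ b c → α * (0ℤ * b) - β * (0ℤ * c) ≡ 0ℤ * γ
    annihilate = solve-∀
    scale : ∀ v d → d ≤ 1ℤ → a v * d ≤ 1ℤ * a v
    scale v d d≤1 with connected? F v q
    ... | yes _ = ℤₚ.≤-refl
    ... | no _  = subst (_≤ 1ℤ) (sym (ℤₚ.*-identityˡ d)) d≤1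
    -- Both endpoints of an edge of `F` have the same value of `a`, so the gradient is that value
    -- times a square that is at most 1.
    bound : ∀ f → ∂ (λ v → a v * flow ρ F v f) f ≤ member F f * a (src f)
    bound f with f ∈? F
    ... | no f∉F rewrite member-∉ f∉F = ℤₚ.≤-reflexive
      (annihilate (a (src f)) (a (tgt f)) (a (src f))
        (away ρ (F ∖ f) (src f) * ∂ (away ρ (F ∖ f)) f) (away ρ (F ∖ f) (tgt f) * ∂ (away ρ (F ∖ f)) f))
    ... | yes f∈F rewrite member-∈ f∈F | sym (away-cong q (connected-edge f∈F)) = subst (_≤ 1ℤ * a (src f))
      (sym (square (a (src f)) (away ρ (F ∖ f) (src f)) (away ρ (F ∖ f) (tgt f))))
      (scale (src f) _ (∂away²≤1 ρ (F ∖ f) f))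

-- Energy identities from summation over all trees and two-forests.

module Counting (G : Multigraph) (q : Fin (n G)) (trees forests : List (Subset (m G)))
  (enumT : Enumerates (IsSpanningTree G) trees) (enumF : Enumerates (IsTwoForest G) forests) where

  open Sums
  open Connectivity G
  open Flows G
  open import Data.Integer using (ℤ; 0ℤ; 1ℤ; _+_; _*_; _-_; _≤_)

  private
    V = Fin (n G)
    E = Fin (m G)

  κ κ₂ : ℤ
  κ  = ∑ trees (λ _ → 1ℤ)
  κ₂ = ∑ forests (λ _ → 1ℤ)

  a : Subset (m G) → V → ℤ
  a = away q

  tree-∈ : ∀ {T} → T List.∈ trees → IsSpanningTree G T
  tree-∈ {T} = proj₁ (proj₂ enumT T)

  forest-∈ : ∀ {F} → F List.∈ forests → IsTwoForest G F
  forest-∈ {F} = proj₁ (proj₂ enumF F)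

  -- T ↦ T ∖ f and F ↦ F ∪₁ f are both restrictions of the involution that toggles f.
  toggle : E → Subset (m G) → Subset (m G)
  toggle f S = updateAt S f not

  toggle-involutive : ∀ f S → toggle f (toggle f S) ≡ S
  toggle-involutive f S = trans (updateAt-updateAt f S) (updateAt-id-local f S (not-involutive _))

  toggle-injective : ∀ f {S S′} → toggle f S ≡ toggle f S′ → S ≡ S′
  toggle-injective f {S} {S′} eq = trans (sym (toggle-involutive f S)) (trans (cong (toggle f) eq) (toggle-involutive f S′))

  toggle-∈ : ∀ {f S} → f ∈ S → toggle f S ≡ S ∖ f
  toggle-∈ {f} {S} f∈S = updateAt-cong-local f S (cong not ([]=⇒lookup f∈S))

  toggle-∉ : ∀ {f S} → ¬ f ∈ S → toggle f S ≡ S ∪₁ f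
  toggle-∉ {f} {S} f∉S = updateAt-cong-local f S (cong not (∉⇒outside f∉S))

  cutBy? : ∀ f F → Dec (¬ Connected G F (src f) (tgt f))
  cutBy? f F = ¬? (connected? F (src f) (tgt f))

  -- Neither list has duplicates, so equal membership, given by the exchange of `f`, already makes
  -- them permutations of each other.
  toggle-↭ : ∀ f → filter (cutBy? f) forests ↭ map (toggle f) (filter (f ∈?_) trees)
  toggle-↭ f = ∼bag⇒↭ (unique∧set⇒bag
    (filter⁺ (cutBy? f) (proj₁ enumF))
    (map⁺ (toggle-injective f) (filter⁺ (f ∈?_) (proj₁ enumT)))
    (mk⇔ to from))
    where
    to : ∀ {F} → F List.∈ filter (cutBy? f) forests → F List.∈ map (toggle f) (filter (f ∈?_) trees)
    to {F} F∈ with F∈forests , cut ← ∈-filter⁻ (cutBy? f) F∈ =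
      subst (List._∈ map (toggle f) (filter (f ∈?_) trees))
        (trans (cong (toggle f) (sym (toggle-∉ f∉F))) (toggle-involutive f F))
        (∈-map⁺ (toggle f) (∈-filter⁺ (f ∈?_)
          (proj₂ (proj₂ enumT (F ∪₁ f)) (forest∪edge (forest-∈ F∈forests) cut)) ([]≔-updates F f)))
      where
      f∉F : ¬ f ∈ F
      f∉F f∈F = cut (connected-edge f∈F)
    from : ∀ {F} → F List.∈ map (toggle f) (filter (f ∈?_) trees) → F List.∈ filter (cutBy? f) forests
    from F∈ with T , T∈ , refl ← ∈-map⁻ (toggle f) F∈ with T∈trees , f∈T ← ∈-filter⁻ (f ∈?_) T∈ =
      subst (List._∈ filter (cutBy? f) forests) (sym (toggle-∈ f∈T))
        (∈-filter⁺ (cutBy? f) (proj₂ (proj₂ enumF (T ∖ f)) (tree∖edge (tree-∈ T∈trees) f∈T))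
          (acyclic⇒cut (proj₁ (tree-∈ T∈trees)) f∈T))

  -- The hypothesis on `h` leaves only the two-forests cut by `f`, and these are the trees through
  -- `f` with `f` removed.
  ∑-forests : ∀ f (h : Subset (m G) → ℤ) →
    (∀ {F} → Connected G F (src f) (tgt f) → h F ≡ 0ℤ) →
    ∑ forests h ≡ ∑ trees (λ T → member T f * h (T ∖ f))
  ∑-forests f h h≡0 = begin
    ∑ forests h                                                 ≡⟨ ∑-filter (cutBy? f) forests h (λ {F} _ ¬cut → uncut F ¬cut) ⟨
    ∑ (filter (cutBy? f) forests) h                             ≡⟨ ∑-↭ h (toggle-↭ f) ⟩
    ∑ (map (toggle f) (filter (f ∈?_) trees)) h                 ≡⟨ ∑-map (toggle f) (filter (f ∈?_) trees) h ⟩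
    ∑ (filter (f ∈?_) trees) (h ∘ toggle f)
      ≡⟨ ∑-cong-∈ (filter (f ∈?_) trees) (λ T∈ → untoggle (proj₂ (∈-filter⁻ (f ∈?_) {xs = trees} T∈))) ⟩
    ∑ (filter (f ∈?_) trees) (λ T → member T f * h (T ∖ f))
      ≡⟨ ∑-filter (f ∈?_) trees _ (λ {T} _ f∉T → cong (_* h (T ∖ f)) (member-∉ f∉T)) ⟩
    ∑ trees (λ T → member T f * h (T ∖ f))                      ∎
    where
    open ≡-Reasoning
    uncut : ∀ F → ¬ ¬ Connected G F (src f) (tgt f) → h F ≡ 0ℤ
    uncut F ¬cut with connected? F (src f) (tgt f)
    ... | yes c = h≡0 c
    ... | no ¬c = contradiction ¬c ¬cut
    untoggle : ∀ {T} → f ∈ T → h (toggle f T) ≡ member T f * h (T ∖ f)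
    untoggle {T} f∈T = trans (cong h (toggle-∈ f∈T))
      (sym (trans (cong (_* h (T ∖ f)) (member-∈ f∈T)) (ℤₚ.*-identityˡ _)))

  ∂a-connected : ∀ {f F} → Connected G F (src f) (tgt f) → ∂ (a F) f ≡ 0ℤ
  ∂a-connected {f} {F} c = trans (cong (_- a F (tgt f)) (away-cong q c)) (ℤₚ.+-inverseʳ (a F (tgt f)))

  -- N v w / κ is the Green function of the Laplacian of G grounded at q.
  N : V → V → ℤ
  N v w = ∑ forests (λ F → a F v * a F w)

  -- The analogue of N (src e) for the contraction G / e.
  M : E → V → ℤ
  M e v = ∑ forests (λ F → member F e * (a F v * a F (src e)))

  t : E → ℤ
  t e = ∑ trees (λ T → member T e)

  N-comm : ∀ v w → N v w ≡ N w v
  N-comm v w = ∑-cong forests (λ F → ℤₚ.*-comm (a F v) (a F w))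

  a-root : ∀ F → a F q ≡ 0ℤ
  a-root F = away-connected connected-refl

  N-root : ∀ w → N q w ≡ 0ℤ
  N-root w = trans (∑-cong forests (λ F → cong (_* a F w) (a-root F))) (∑-zero forests)

  M-root : ∀ e → M e q ≡ 0ℤ
  M-root e = trans (∑-cong forests (λ F → trans (cong (λ z → member F e * (z * a F (src e))) (a-root F)) (ℤₚ.*-zeroʳ (member F e)))) (∑-zero forests)

  -- Only two-forests cut by `f` contribute to the difference; adding `f` turns the contribution of
  -- each into the flow of a tree.
  ∂N : ∀ w f → ∂ (λ v → N v w) f ≡ ∑ trees (λ T → flow q T w f)
  ∂N w f = begin
    ∂ (λ v → N v w) f                                       ≡⟨ ∑-- forests _ _ ⟨
    ∑ forests (λ F → ∂ (λ v → a F v * a F w) f)             ≡⟨ ∑-cong forests (λ F → factor (a F (src f)) (a F (tgt f)) (a F w)) ⟩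
    ∑ forests (λ F → a F w * ∂ (a F) f)                     ≡⟨ ∑-forests f (λ F → a F w * ∂ (a F) f)
      (λ {F} c → trans (cong (a F w *_) (∂a-connected c)) (ℤₚ.*-zeroʳ (a F w))) ⟩
    ∑ trees (λ T → flow q T w f)                            ∎
    where
    open ≡-Reasoning
    factor : ∀ x y z → x * z - y * z ≡ z * (x - y)
    factor = solve-∀

  -- In every tree the flow from `w` to `q` pairs with `∂ φ` to the same value `φ w - φ q`. For
  -- indicators `φ` this is the Laplace equation of the Green function.
  energy-N : ∀ w (φ : V → ℤ) → ∑ edges (λ f → ∂ (λ v → N v w) f * ∂ φ f) ≡ κ * (φ w - φ q)
  energy-N w φ = begin
    ∑ edges (λ f → ∂ (λ v → N v w) f * ∂ φ f)               ≡⟨ ∑-cong edges (λ f → cong (_* ∂ φ f) (∂N w f)) ⟩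
    ∑ edges (λ f → ∑ trees (λ T → flow q T w f) * ∂ φ f)    ≡⟨ ∑-cong edges (λ f → ∑-*ʳ (∂ φ f) trees (λ T → flow q T w f)) ⟨
    ∑ edges (λ f → ∑ trees (λ T → flow q T w f * ∂ φ f))    ≡⟨ ∑-swap edges trees (λ f T → flow q T w f * ∂ φ f) ⟩
    ∑ trees (λ T → ∑ edges (λ f → flow q T w f * ∂ φ f))    ≡⟨ ∑-cong-∈ trees (λ T∈ →
      flow-telescope (proj₁ (tree-∈ T∈)) (proj₂ (tree-∈ T∈) w q) φ) ⟩
    ∑ trees (λ _ → φ w - φ q)                               ≡⟨ ∑-cong trees (λ _ → sym (ℤₚ.*-identityˡ (φ w - φ q))) ⟩
    ∑ trees (λ _ → 1ℤ * (φ w - φ q))                        ≡⟨ ∑-*ʳ (φ w - φ q) trees (λ _ → 1ℤ) ⟩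
    κ * (φ w - φ q)                                         ∎
    where open ≡-Reasoning

  -- As for `∂N`, except that the two-forest `T ∖ f` must still contain `e`: this restricts to trees
  -- through `e` and removes the case `f` = `e`, which is the `δ` term.
  ∂M : ∀ e f → ∂ (M e) f ≡ ∑ trees (λ T → member T e * (flow q T (src e) f - δ e f * flow q T (src e) f))
  ∂M e f = begin
    ∂ (M e) f                                               ≡⟨ ∑-- forests _ _ ⟨
    ∑ forests (λ F → ∂ (λ v → member F e * (a F v * a F (src e))) f)
      ≡⟨ ∑-cong forests (λ F → factor (member F e) (a F (src f)) (a F (tgt f)) (a F (src e))) ⟩
    ∑ forests h                                             ≡⟨ ∑-forests f h (λ {F} c →
      trans (cong (λ d → member F e * (a F (src e) * d)) (∂a-connected c)) (annihilate (member F e) (a F (src e)))) ⟩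
    ∑ trees (λ T → member T f * h (T ∖ f))                  ≡⟨ ∑-cong trees (λ T →
      trans (cong (λ z → member T f * (z * (a (T ∖ f) (src e) * ∂ (a (T ∖ f)) f))) (member-∖ T e f))
        (rearrange (member T f) (member T e) (δ e f) (a (T ∖ f) (src e) * ∂ (a (T ∖ f)) f))) ⟩
    ∑ trees (λ T → member T e * (flow q T (src e) f - δ e f * flow q T (src e) f)) ∎
    where
    open ≡-Reasoning
    h : Subset (m G) → ℤ
    h F = member F e * (a F (src e) * ∂ (a F) f)
    factor : ∀ i x y z → i * (x * z) - i * (y * z) ≡ i * (z * (x - y))
    factor = solve-∀
    annihilate : ∀ x y → x * (y * 0ℤ) ≡ 0ℤ
    annihilate = solve-∀
    rearrange : ∀ i j d x → i * ((j - d * j) * x) ≡ j * (i * x - d * (i * x))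
    rearrange = solve-∀

  -- The trees through `e` contribute as in `energy-N`. The edge `e` is left out of their flows, and
  -- by `∂N` the omitted terms add up to the product that is subtracted.
  energy-M : ∀ e (φ : V → ℤ) → ∑ edges (λ f → ∂ (M e) f * ∂ φ f) ≡
    t e * (φ (src e) - φ q) - ∂ (λ v → N v (src e)) e * ∂ φ e
  energy-M e φ = begin
    ∑ edges (λ f → ∂ (M e) f * ∂ φ f)
      ≡⟨ ∑-cong edges (λ f → trans (cong (_* ∂ φ f) (∂M e f)) (sym (∑-*ʳ (∂ φ f) trees _))) ⟩
    ∑ edges (λ f → ∑ trees (λ T → member T e * (flow q T (src e) f - δ e f * flow q T (src e) f) * ∂ φ f))
      ≡⟨ ∑-swap edges trees _ ⟩
    ∑ trees (λ T → ∑ edges (λ f → member T e * (flow q T (src e) f - δ e f * flow q T (src e) f) * ∂ φ f))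
      ≡⟨ ∑-cong-∈ trees per-tree ⟩
    ∑ trees (λ T → member T e * (φ (src e) - φ q) - flow q T (src e) e * ∂ φ e)
      ≡⟨ ∑-- trees _ _ ⟩
    ∑ trees (λ T → member T e * (φ (src e) - φ q)) - ∑ trees (λ T → flow q T (src e) e * ∂ φ e)
      ≡⟨ cong₂ _-_ (∑-*ʳ (φ (src e) - φ q) trees (λ T → member T e)) (∑-*ʳ (∂ φ e) trees (λ T → flow q T (src e) e)) ⟩
    t e * (φ (src e) - φ q) - ∑ trees (λ T → flow q T (src e) e) * ∂ φ e
      ≡⟨ cong (λ s → t e * (φ (src e) - φ q) - s * ∂ φ e) (sym (∂N (src e) e)) ⟩
    t e * (φ (src e) - φ q) - ∂ (λ v → N v (src e)) e * ∂ φ e ∎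
    where
    open ≡-Reasoning
    distrib : ∀ i x d y → i * (x - d * x) * y ≡ i * (x * y - d * (x * y))
    distrib = solve-∀
    absorb : ∀ i p x y → i * (p - i * x * y) ≡ i * p - (i * i) * x * y
    absorb = solve-∀
    per-tree : ∀ {T} → T List.∈ trees →
      ∑ edges (λ f → member T e * (flow q T (src e) f - δ e f * flow q T (src e) f) * ∂ φ f) ≡
      member T e * (φ (src e) - φ q) - flow q T (src e) e * ∂ φ e
    per-tree {T} T∈ = begin
      ∑ edges (λ f → member T e * (x f - δ e f * x f) * ∂ φ f)
        ≡⟨ ∑-cong edges (λ f → distrib (member T e) (x f) (δ e f) (∂ φ f)) ⟩
      ∑ edges (λ f → member T e * (x f * ∂ φ f - δ e f * (x f * ∂ φ f)))
        ≡⟨ trans (∑-*ˡ (member T e) edges _) (cong (member T e *_) (∑-- edges _ _)) ⟩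
      member T e * (∑ edges (λ f → x f * ∂ φ f) - ∑ edges (λ f → δ e f * (x f * ∂ φ f)))
        ≡⟨ cong₂ (λ s s′ → member T e * (s - s′))
             (flow-telescope (proj₁ (tree-∈ T∈)) (proj₂ (tree-∈ T∈) (src e) q) φ) (∑-δ e (λ f → x f * ∂ φ f)) ⟩
      -- The flow `x e` already has the factor `member T e`, so a second one is absorbed.
      member T e * ((φ (src e) - φ q) - x e * ∂ φ e)
        ≡⟨ absorb (member T e) (φ (src e) - φ q) (a (T ∖ e) (src e) * ∂ (a (T ∖ e)) e) (∂ φ e) ⟩
      member T e * (φ (src e) - φ q) - (member T e * member T e) * (a (T ∖ e) (src e) * ∂ (a (T ∖ e)) e) * ∂ φ e
        ≡⟨ cong (λ i → member T e * (φ (src e) - φ q) - i * (a (T ∖ e) (src e) * ∂ (a (T ∖ e)) e) * ∂ φ e) (member-idem T e) ⟩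
      member T e * (φ (src e) - φ q) - x e * ∂ φ e ∎
      where
      x : E → ℤ
      x = flow q T (src e)

  -- Trees using e with src e (s) respectively tgt e (s′) as the endpoint farther from q.
  s s′ : E → ℤ
  s e = N (src e) (src e) - N (tgt e) (src e)
  s′ e = N (tgt e) (tgt e) - N (src e) (tgt e)

  -- Removing `e` from a tree through it cuts exactly one endpoint off from `q`, so each such tree
  -- is counted by a squared gradient equal to 1; expanding the square separates the two directions.
  t≡s+s′ : ∀ e → t e ≡ s e + s′ e
  t≡s+s′ e = begin
    ∑ trees (λ T → member T e)                              ≡⟨ ∑-cong-∈ trees cut-tree ⟩
    ∑ trees (λ T → member T e * h (T ∖ e))                  ≡⟨ ∑-forests e h (λ {F} c → cong (_* ∂ (a F) e) (∂a-connected c)) ⟨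
    ∑ forests h                                             ≡⟨ ∑-cong forests (λ F → expand (a F (src e)) (a F (tgt e))) ⟩
    ∑ forests (λ F → ∂ (λ v → a F v * a F (src e)) e + (a F (tgt e) * a F (tgt e) - a F (src e) * a F (tgt e)))
      ≡⟨ ∑-+ forests _ _ ⟩
    ∑ forests (λ F → ∂ (λ v → a F v * a F (src e)) e) + ∑ forests (λ F → a F (tgt e) * a F (tgt e) - a F (src e) * a F (tgt e))
      ≡⟨ cong₂ _+_ (∑-- forests _ _) (∑-- forests _ _) ⟩
    s e + s′ e                                              ∎
    where
    open ≡-Reasoning
    h : Subset (m G) → ℤ
    h F = ∂ (a F) e * ∂ (a F) e
    expand : ∀ x y → (x - y) * (x - y) ≡ (x * x - y * x) + (y * y - x * y)
    expand = solve-∀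
    cut-tree : ∀ {T} → T List.∈ trees → member T e ≡ member T e * h (T ∖ e)
    cut-tree {T} T∈ with e ∈? T
    ... | yes e∈T = sym (trans (cong (member T e *_)
      (∂away²-cut (proj₁ (tree-∈ T∈)) e∈T (proj₂ (tree-∈ T∈) (src e) q))) (ℤₚ.*-identityʳ _))
    ... | no e∉T = trans (member-∉ e∉T) (sym (cong (_* h (T ∖ e)) (member-∉ e∉T)))

  -- The pairing of the gradients of `M e` and of `N` with second argument `src e` is evaluated
  -- twice, by `energy-N` and by `energy-M`; both potentials vanish at `q`.
  κ*M : ∀ e → κ * M e (src e) ≡ t e * N (src e) (src e) - s e * s e
  κ*M e = begin
    κ * M e (src e)                                         ≡⟨ cong (κ *_) (minus-zero (M e (src e)) (M-root e)) ⟨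
    κ * (M e (src e) - M e q)                               ≡⟨ energy-N (src e) (M e) ⟨
    ∑ edges (λ f → ∂ g f * ∂ (M e) f)                       ≡⟨ ∑-cong edges (λ f → ℤₚ.*-comm (∂ g f) (∂ (M e) f)) ⟩
    ∑ edges (λ f → ∂ (M e) f * ∂ g f)                       ≡⟨ energy-M e g ⟩
    t e * (g (src e) - g q) - s e * s e                     ≡⟨ cong (λ z → t e * z - s e * s e) (minus-zero (g (src e)) (N-root (src e))) ⟩
    t e * N (src e) (src e) - s e * s e                     ∎
    where
    open ≡-Reasoning
    g : V → ℤ
    g v = N v (src e)
    minus-zero : ∀ x {z} → z ≡ 0ℤ → x - z ≡ x
    minus-zero x refl = ℤₚ.+-identityʳ x

  -- energy-N for φ the indicator of v, weighted by g v and summed over v.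
  weighted-vertices : ∀ (g : V → ℤ) → ∑ vertices (λ v → (1ℤ - δ q v) * g v) * κ ≡
    ∑ edges (λ f → g (src f) * s f + g (tgt f) * s′ f)
  weighted-vertices g = begin
    ∑ vertices (λ v → (1ℤ - δ q v) * g v) * κ               ≡⟨ ∑-*ʳ κ vertices _ ⟨
    ∑ vertices (λ v → (1ℤ - δ q v) * g v * κ)               ≡⟨ ∑-cong vertices (λ v → trans
      (rearrange (1ℤ - δ q v) (g v) κ) (cong (λ z → g v * (κ * (z - δ q v))) (sym (δ-refl v)))) ⟩
    ∑ vertices (λ v → g v * (κ * (δ v v - δ q v)))          ≡⟨ ∑-cong vertices (λ v → cong (g v *_) (sym (energy-N v (λ u → δ u v)))) ⟩
    ∑ vertices (λ v → g v * ∑ edges (λ f → ∂N′ v f * ∂ (λ u → δ u v) f))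
      ≡⟨ ∑-cong vertices (λ v → trans (sym (∑-*ˡ (g v) edges _)) (∑-cong edges (λ f → commute (g v) (∂N′ v f) (∂ (λ u → δ u v) f)))) ⟩
    ∑ vertices (λ v → ∑ edges (λ f → ∂ (λ u → δ u v) f * (g v * ∂N′ v f)))
      ≡⟨ ∑-swap vertices edges _ ⟩
    ∑ edges (λ f → ∑ vertices (λ v → ∂ (λ u → δ u v) f * (g v * ∂N′ v f)))
      -- At `tgt f` the gradient of `N` along `f` is the negative of `s′ f`; the minus sign of `∂`
      -- cancels this.
      ≡⟨ ∑-cong edges (λ f → trans (∑-∂δ f (λ v → g v * ∂N′ v f))
           (signs (g (src f)) (g (tgt f)) (s f) (N (src f) (tgt f)) (N (tgt f) (tgt f)))) ⟩
    ∑ edges (λ f → g (src f) * s f + g (tgt f) * s′ f)      ∎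
    where
    open ≡-Reasoning
    ∂N′ : V → E → ℤ
    ∂N′ w = ∂ (λ v → N v w)
    rearrange : ∀ x y z → x * y * z ≡ y * (z * x)
    rearrange = solve-∀
    commute : ∀ x y z → x * (y * z) ≡ z * (x * y)
    commute = solve-∀
    signs : ∀ x y z c b → x * z - y * (c - b) ≡ x * z + y * (b - c)
    signs = solve-∀

  -- The constant weight 1 shows that a tree has on average one edge fewer than there are vertices,
  -- `q` being the vertex that drops out.
  ∑t : ∑ edges t ≡ (∑ vertices (λ _ → 1ℤ) - 1ℤ) * κ
  ∑t = begin
    ∑ edges t                                               ≡⟨ ∑-cong edges (λ f → trans (t≡s+s′ f) (units (s f) (s′ f))) ⟩
    ∑ edges (λ f → 1ℤ * s f + 1ℤ * s′ f)                    ≡⟨ weighted-vertices (λ _ → 1ℤ) ⟨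
    ∑ vertices (λ v → (1ℤ - δ q v) * 1ℤ) * κ                ≡⟨ cong (_* κ) (∑-cong vertices (λ v → distrib (δ q v))) ⟩
    ∑ vertices (λ v → 1ℤ - δ q v * 1ℤ) * κ                  ≡⟨ cong (_* κ) (∑-- vertices _ _) ⟩
    (∑ vertices (λ _ → 1ℤ) - ∑ vertices (λ v → δ q v * 1ℤ)) * κ
      ≡⟨ cong (λ z → (∑ vertices (λ _ → 1ℤ) - z) * κ) (∑-δ q (λ _ → 1ℤ)) ⟩
    (∑ vertices (λ _ → 1ℤ) - 1ℤ) * κ                        ∎
    where
    open ≡-Reasoning
    units : ∀ x y → x + y ≡ 1ℤ * x + 1ℤ * y
    units = solve-∀
    distrib : ∀ d → (1ℤ - d) * 1ℤ ≡ 1ℤ - d * 1ℤ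
    distrib = solve-∀

  -- The weight `N v v` vanishes at `q`, so the excluded vertex can be restored.
  ∑N : ∑ vertices (λ v → N v v) * κ ≡ ∑ edges (λ f → N (src f) (src f) * s f + N (tgt f) (tgt f) * s′ f)
  ∑N = trans (cong (_* κ) drop-root) (weighted-vertices (λ v → N v v))
    where
    open ≡-Reasoning
    distrib : ∀ d x → (1ℤ - d) * x ≡ x - d * x
    distrib = solve-∀
    drop-root : ∑ vertices (λ v → N v v) ≡ ∑ vertices (λ v → (1ℤ - δ q v) * N v v)
    drop-root = sym (begin
      ∑ vertices (λ v → (1ℤ - δ q v) * N v v)               ≡⟨ ∑-cong vertices (λ v → distrib (δ q v) (N v v)) ⟩
      ∑ vertices (λ v → N v v - δ q v * N v v)              ≡⟨ ∑-- vertices _ _ ⟩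
      ∑ vertices (λ v → N v v) - ∑ vertices (λ v → δ q v * N v v)
        ≡⟨ cong (∑ vertices (λ v → N v v) -_) (trans (∑-δ q (λ v → N v v)) (N-root q)) ⟩
      ∑ vertices (λ v → N v v) - 0ℤ                         ≡⟨ ℤₚ.+-identityʳ _ ⟩
      ∑ vertices (λ v → N v v)                              ∎)

  -- Summed over all two-forests, the bound of the vertices away from `q` by the edges there;
  -- squares of the indicator `a` can be inserted or removed freely.
  ∑N≤κ₂+∑M : ∑ vertices (λ v → N v v) ≤ κ₂ + ∑ edges (λ e → M e (src e))
  ∑N≤κ₂+∑M = begin
    ∑ vertices (λ v → N v v)                                ≡⟨ ∑-swap vertices forests (λ v F → a F v * a F v) ⟩
    ∑ forests (λ F → ∑ vertices (λ v → a F v * a F v))      ≡⟨ ∑-cong forests (λ F → ∑-cong vertices (away-idem q F)) ⟩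
    ∑ forests (λ F → ∑ vertices (a F))                      ≤⟨ ∑-mono-∈ forests (λ F∈ → away-vertices≤1+away-edges (forest-∈ F∈) q) ⟩
    ∑ forests (λ F → 1ℤ + ∑ edges (λ e → member F e * a F (src e)))
      ≡⟨ ∑-+ forests _ _ ⟩
    κ₂ + ∑ forests (λ F → ∑ edges (λ e → member F e * a F (src e)))
      ≡⟨ cong (κ₂ +_) (∑-cong forests (λ F → ∑-cong edges (λ e → cong (member F e *_) (sym (away-idem q F (src e)))))) ⟩
    κ₂ + ∑ forests (λ F → ∑ edges (λ e → member F e * (a F (src e) * a F (src e))))
      ≡⟨ cong (κ₂ +_) (∑-swap forests edges _) ⟩
    κ₂ + ∑ edges (λ e → M e (src e))                        ∎
    where open ℤₚ.≤-Reasoning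

  -- The quadratic estimate on each edge and its sum.

  κ-nonNegative : ℤ.NonNegative κ
  κ-nonNegative = subst ℤ.NonNegative (sym (∑-one trees)) _

  -- With x = A - C and y = B - C this is (x + y)² ≤ 4 (x² - x y + y²) = (x + y)² + 3 (x - y)².
  quadratic-bound : ∀ A B C → ((A - C) + (B - C)) * ((A - C) + (B - C)) ≤
    ℤ.+ 4 * ((A * (A - C) + B * (B - C)) - (((A - C) + (B - C)) * A - (A - C) * (A - C)))
  quadratic-bound A B C = subst (((A - C) + (B - C)) * ((A - C) + (B - C)) ≤_) (sym (identity A B C))
    (subst (_≤ ((A - C) + (B - C)) * ((A - C) + (B - C)) + ℤ.+ 3 * ((A - B) * (A - B))) (ℤₚ.+-identityʳ _)
      (ℤₚ.+-monoʳ-≤ (((A - C) + (B - C)) * ((A - C) + (B - C))) (ℤₚ.*-monoˡ-≤-nonNeg (ℤ.+ 3) (0≤i*i (A - B)))))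
    where
    identity : ∀ A B C → ℤ.+ 4 * ((A * (A - C) + B * (B - C)) - (((A - C) + (B - C)) * A - (A - C) * (A - C))) ≡
      ((A - C) + (B - C)) * ((A - C) + (B - C)) + ℤ.+ 3 * ((A - B) * (A - B))
    identity = solve-∀

  -- By symmetry of `N`, `s e` is `A - C` and `s′ e` is `B - C`. With `κ*M` the bracket is the
  -- quadratic form s² - s s′ + s′² of the overview.
  t²-bound : ∀ e → t e * t e ≤
    ℤ.+ 4 * ((N (src e) (src e) * s e + N (tgt e) (tgt e) * s′ e) - κ * M e (src e))
  t²-bound e = begin
    t e * t e                                               ≡⟨ cong (λ z → z * z) (trans (t≡s+s′ e) (cong (s e +_) s′≡)) ⟩
    ((A - C) + (B - C)) * ((A - C) + (B - C))               ≤⟨ quadratic-bound A B C ⟩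
    ℤ.+ 4 * ((A * (A - C) + B * (B - C)) - (((A - C) + (B - C)) * A - (A - C) * (A - C)))
      ≡⟨ cong₂ (λ z w → ℤ.+ 4 * ((A * s e + B * z) - (w * A - s e * s e))) s′≡
           (trans (t≡s+s′ e) (cong (s e +_) s′≡)) ⟨
    ℤ.+ 4 * ((A * s e + B * s′ e) - (t e * A - s e * s e))  ≡⟨ cong (λ z → ℤ.+ 4 * ((A * s e + B * s′ e) - z)) (κ*M e) ⟨
    ℤ.+ 4 * ((A * s e + B * s′ e) - κ * M e (src e))        ∎
    where
    open ℤₚ.≤-Reasoning
    A B C : ℤ
    A = N (src e) (src e)
    B = N (tgt e) (tgt e)
    C = N (tgt e) (src e)
    s′≡ : s′ e ≡ B - C
    s′≡ = cong (B -_) (N-comm (src e) (tgt e))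

  ∑t²≤4κκ₂ : ∑ edges (λ e → t e * t e) ≤ ℤ.+ 4 * (κ * κ₂)
  ∑t²≤4κκ₂ = begin
    ∑ edges (λ e → t e * t e)                               ≤⟨ ∑-mono-∈ edges (λ {e} _ → t²-bound e) ⟩
    ∑ edges (λ e → ℤ.+ 4 * (P e - κ * M e (src e)))         ≡⟨ ∑-*ˡ (ℤ.+ 4) edges (λ e → P e - κ * M e (src e)) ⟩
    ℤ.+ 4 * ∑ edges (λ e → P e - κ * M e (src e))           ≡⟨ cong (ℤ.+ 4 *_) (∑-- edges P (λ e → κ * M e (src e))) ⟩
    ℤ.+ 4 * (∑ edges P - ∑ edges (λ e → κ * M e (src e)))   ≡⟨ cong₂ (λ x y → ℤ.+ 4 * (x - y)) (sym ∑N) (∑-*ˡ κ edges (λ e → M e (src e))) ⟩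
    ℤ.+ 4 * (ΣN * κ - κ * ΣM)                               ≡⟨ cong (ℤ.+ 4 *_) (factor κ ΣN ΣM) ⟩
    ℤ.+ 4 * (κ * (ΣN - ΣM))                                 ≤⟨ ℤₚ.*-monoˡ-≤-nonNeg (ℤ.+ 4) (ℤₚ.*-monoˡ-≤-nonNeg κ {{κ-nonNegative}} excess) ⟩
    ℤ.+ 4 * (κ * κ₂)                                        ∎
    where
    open ℤₚ.≤-Reasoning
    P : E → ℤ
    P e = N (src e) (src e) * s e + N (tgt e) (tgt e) * s′ e
    ΣN ΣM : ℤ
    ΣN = ∑ vertices (λ v → N v v)
    ΣM = ∑ edges (λ e → M e (src e))
    factor : ∀ k x y → x * k - k * y ≡ k * (x - y)
    factor = solve-∀
    cancel : ∀ x y → (x + y) - y ≡ x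
    cancel = solve-∀
    -- This is the vertex-edge count; multiplying it by `κ` keeps its direction because `κ` is
    -- nonnegative.
    excess : ΣN - ΣM ≤ κ₂
    excess = subst (ΣN - ΣM ≤_) (cancel κ₂ ΣM) (ℤₚ.+-monoˡ-≤ (ℤ.- ΣM) ∑N≤κ₂+∑M)

  tree-forest-bound : 1 ℕ.≤ n G →
    (n G ℕ.∸ 1) ℕ.* length trees ℕ.* ((n G ℕ.∸ 1) ℕ.* length trees) ℕ.≤
    m G ℕ.* (4 ℕ.* (length trees ℕ.* length forests))
  tree-forest-bound 1≤n = ℤₚ.drop‿+≤+ (begin
    ℤ.+ (d ℕ.* k ℕ.* (d ℕ.* k))                             ≡⟨ ℤₚ.pos-* (d ℕ.* k) (d ℕ.* k) ⟩
    ℤ.+ (d ℕ.* k) * ℤ.+ (d ℕ.* k)                           ≡⟨ cong (λ z → z * z) ∑t≡ ⟨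
    ∑ edges t * ∑ edges t                                   ≤⟨ cauchy-schwarz edges t ⟩
    ℤ.+ length edges * ∑ edges (λ e → t e * t e)            ≤⟨ ℤₚ.*-monoˡ-≤-nonNeg (ℤ.+ length edges) ∑t²≤4κκ₂ ⟩
    ℤ.+ length edges * (ℤ.+ 4 * (κ * κ₂))                   ≡⟨ cong₂ (λ i z → ℤ.+ i * (ℤ.+ 4 * z)) (length-tabulate {n = m G} id)
                                                                 (cong₂ _*_ (∑-one trees) (∑-one forests)) ⟩
    ℤ.+ m G * (ℤ.+ 4 * (ℤ.+ k * ℤ.+ l))                     ≡⟨ cong (λ z → ℤ.+ m G * (ℤ.+ 4 * z)) (ℤₚ.pos-* k l) ⟨
    ℤ.+ m G * (ℤ.+ 4 * ℤ.+ (k ℕ.* l))                       ≡⟨ cong (ℤ.+ m G *_) (ℤₚ.pos-* 4 (k ℕ.* l)) ⟨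
    ℤ.+ m G * ℤ.+ (4 ℕ.* (k ℕ.* l))                         ≡⟨ ℤₚ.pos-* (m G) (4 ℕ.* (k ℕ.* l)) ⟨
    ℤ.+ (m G ℕ.* (4 ℕ.* (k ℕ.* l)))                         ∎)
    where
    open ℤₚ.≤-Reasoning
    d k l : ℕ
    d = n G ℕ.∸ 1
    k = length trees
    l = length forests
    -- Truncated and integer subtraction agree here because there is at least one vertex.
    vertices-1 : ∑ vertices (λ _ → 1ℤ) - 1ℤ ≡ ℤ.+ d
    vertices-1 = trans (cong (_- 1ℤ) (trans (∑-one vertices) (cong ℤ.+_ (length-tabulate {n = n G} id))))
      (trans (ℤₚ.m-n≡m⊖n (n G) 1) (ℤₚ.⊖-≥ 1≤n))
    ∑t≡ : ∑ edges t ≡ ℤ.+ (d ℕ.* k)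
    ∑t≡ = trans ∑t (trans (cong₂ _*_ vertices-1 (∑-one trees)) (sym (ℤₚ.pos-* d k)))

-- Cancellation of the number of trees in the natural numbers.

open import Data.Nat using (ℕ; _≤_; _*_; _∸_)

-- For `k` = 0 the left side of the conclusion vanishes; otherwise one factor `k` cancels.
*-square-cancel : ∀ d k m l → d * k * (d * k) ≤ m * (4 * (k * l)) → d * d * k ≤ 4 * m * l
*-square-cancel d ℕ.zero m l _ = subst (_≤ 4 * m * l) (sym (ℕₚ.*-zeroʳ (d * d))) ℕ.z≤n
*-square-cancel d k@(ℕ.suc _) m l le = ℕₚ.*-cancelʳ-≤ (d * d * k) (4 * m * l) k
  (subst₂ _≤_ (left d k) (right k m l) le)
  where
  left : ∀ d k → d * k * (d * k) ≡ d * d * k * k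
  left = ℕ-solve-∀
  right : ∀ k m l → m * (4 * (k * l)) ≡ 4 * m * l * k
  right = ℕ-solve-∀

theorem6p1 : (G : Multigraph) → Loopless G → IsConnectedGraph G → 2 ≤ n G →
    (trees twoForests : List (Subset (m G))) →
    Enumerates (IsSpanningTree G) trees → Enumerates (IsTwoForest G) twoForests →
    ((n G ∸ 1) * (n G ∸ 1)) * length trees ≤ (4 * m G) * length twoForests
theorem6p1 G _ _ 2≤n trees twoForests enumT enumF =
  -- The grounded vertex `q` is vertex 0.
  *-square-cancel (n G ∸ 1) (length trees) (m G) (length twoForests)
    (Counting.tree-forest-bound G (fromℕ< 1≤n) trees twoForests enumT enumF 1≤n)
  where
  1≤n : 1 ≤ n G
  1≤n = ℕₚ.<⇒≤ 2≤n
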